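{- Let $G$ be a directed or undirected graph with labeled edges, and let $\mathrm{nr}(G)$ be its associated directed graph. If $\pi$ is a path in $\mathrm{nr}(G)$, then the sequence of gadgets through which $\pi$ passes corresponds to a nonrepetitive path in $G$; that is, the sequence of vertices of $G$ whose gadgets $\pi$ successively visits, together with the edges of $G$ giving rise to the inter-gadget edges used by $\pi$, is a nonrepetitive path in $G$. Conversely, if $\pi$ is a nonrepetitive path in $G$, there exists a path in $\mathrm{nr}(G)$ that passes through a sequence of gadgets corresponding to the vertices of $\pi$ (in the order in which $\pi$ visits them).
   Context: Graphs are finite, each edge carries one label, and multiple edges are allowed. Isolated vertices are disregarded. Paths are not required to be simple: a path may repeat vertices and edges. A path in an edge-labeled graph is nonrepetitive if no two consecutive edges of it share the same label. The gadgets $D_k$. For $k\ge 1$, $D_k$ is a directed graph containing $2k$ distinct vertices labeled $1,\dots,k$ and $\bar 1,\dots,\bar k$ (and possibly other vertices), defined recursively. $D_1$ consists of the two vertices $1,\bar 1$ and no edges. $D_2$ consists of the four vertices $1,2,\bar 1,\bar 2$ with edges $1\to\bar 2$ and $2\to\bar 1$. For $k\ge 3$, take a copy $D'$ of $D_{\lceil k/2\rceil}$ and add new vertices labeled $1,\dots,k,\bar 1,\dots,\bar k$ (the labeled vertices of $D_k$ are these new ones). For each $1\le x\le k$ let $y=x+1$ if $x$ is odd, $y=x-1$ if $x$ is even, and $z=\lceil x/2\rceil$; add an edge from $x$ to $\bar y$ (if $y\le k$), an edge from $x$ to the vertex labeled $z$ of $D'$, and an edge from the vertex labeled $\bar z$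 of $D'$ to $\bar x$. The graph $\mathrm{nr}(G)$. For each vertex $v$ of $G$, let $k_v$ be the number of distinct labels on edges incident to $v$ (incoming or outgoing, if $G$ is directed); $\mathrm{nr}(G)$ contains a separate copy of $D_{k_v}$, called the gadget of $v$, whose labeled vertices are renamed bijectively by the labels at $v$, so that each label $x$ at $v$ has a vertex $x$ and a vertex $\bar x$ in the gadget of $v$. For each edge $(v,w)$ of $G$ labeled $x$, $\mathrm{nr}(G)$ has a directed edge (an inter-gadget edge) from the vertex $\bar x$ of $v$'s gadget to the vertex $x$ of $w$'s gadget. If $G$ is undirected, each edge is treated as two oppositely oriented directed edges with the same label. The sequence of gadgets through which a path in $\mathrm{nr}(G)$ passes starts with the gadget containing its first vertex, and gains a new entry (the gadget entered) each time the path traverses an inter-gadget edge. -}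

module Defs where

open import Level using (Level; _⊔_) renaming (suc to lsuc)
open import Data.Nat.Base using (ℕ; suc; pred; _+_; ⌈_/2⌉; parity)
open import Data.Parity.Base using (0ℙ; 1ℙ)
open import Data.Fin.Base using (Fin; zero; suc; toℕ)
import Data.Fin.Properties as Fin
open import Data.List.Base using (List; []; _∷_; map; filter; deduplicate; length; lookup; allFin)
open import Data.List.Membership.Propositional using (_∈_)
open import Data.List.Membership.Propositional.Properties
  using (∈-lookup; ∈-map⁺; ∈-map⁻; ∈-filter⁺; ∈-filter⁻; ∈-allFin; ∈-deduplicate⁺; ∈-deduplicate⁻)
open import Data.List.Relation.Unary.Any using (index)
open import Data.List.Relation.Unary.Any.Properties using (lookup-index)
open import Data.List.Relation.Unary.All using () renaming (lookup to All-lookup)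
open import Data.List.Relation.Unary.AllPairs using (_∷_)
open import Data.List.Relation.Unary.Linked using (Linked)
open import Data.List.Relation.Unary.Unique.Propositional using (Unique)
import Data.List.Relation.Unary.Unique.DecPropositional.Properties as UniqueDec
open import Data.Product.Base using (Σ; ∃-syntax; _×_; _,_; proj₂)
open import Data.Sum.Base using (_⊎_)
open import Data.Empty using (⊥-elim)
open import Function.Definitions using (Injective)
open import Relation.Nullary.Decidable using (Dec; _⊎-dec_)
open import Relation.Binary.Definitions using (DecidableEquality)
open import Relation.Binary.Construct.Closure.ReflexiveTransitive using (Star; ε; _◅_)
open import Relation.Binary.PropositionalEquality using (_≡_; _≢_; refl; sym; cong)

data Kind : Set where
  directed undirected : Kind

-- Loops and multiple edges are allowed.  When the kind is undirected, the
-- choice of which end of an edge is called its source carries no meaning: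
-- see Arc below.
record Graph (ℓ : Level) : Set (lsuc ℓ) where
  field
    kind           : Kind
    #vertices      : ℕ
    #edges         : ℕ
    Label          : Set ℓ
    _≟ᴸ_           : DecidableEquality Label

  Vertex : Set
  Vertex = Fin #vertices

  Edge : Set
  Edge = Fin #edges

  field
    source target  : Edge → Vertex
    label          : Edge → Label

module _ {ℓ} (G : Graph ℓ) where
  open Graph G

  Incident : Vertex → Edge → Set
  Incident v e = source e ≡ v ⊎ target e ≡ v

  incident? : ∀ v e → Dec (Incident v e)
  incident? v e = (source e Fin.≟ v) ⊎-dec (target e Fin.≟ v)

  NoIsolatedVertices : Set
  NoIsolatedVertices = ∀ v → ∃[ e ] Incident v e

  LabelAt : Vertex → Label → Set ℓ
  LabelAt v x = ∃[ e ] (Incident v e × label e ≡ x)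

  edgesAt : Vertex → List Edge
  edgesAt v = filter (incident? v) (allFin #edges)

  labelsAt : Vertex → List Label
  labelsAt v = deduplicate _≟ᴸ_ (map label (edgesAt v))

  #labelsAt : Vertex → ℕ
  #labelsAt v = length (labelsAt v)

  data Arc : Vertex → Vertex → Set where
    forward  : (e : Edge) → Arc (source e) (target e)
    backward : kind ≡ undirected → (e : Edge) → Arc (target e) (source e)

  Path : Vertex → Vertex → Set
  Path = Star Arc

module _ {ℓ} {G : Graph ℓ} where
  open Graph G

  edge : ∀ {u v} → Arc G u v → Edge
  edge (forward e)    = e
  edge (backward _ e) = e

  vertices : ∀ {u v} → Path G u v → List Vertex
  vertices {u} ε       = u ∷ []
  vertices {u} (_ ◅ π) = u ∷ vertices π

  edges : ∀ {u v} → Path G u v → List Edge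
  edges ε       = []
  edges (a ◅ π) = edge a ∷ edges π

  Nonrepetitive : ∀ {u v} → Path G u v → Set ℓ
  Nonrepetitive π = Linked _≢_ (map label (edges π))

-- The labels 1, …, k are represented by Fin k.
number : ∀ {k} → Fin k → ℕ
number i = suc (toℕ i)

partner : ℕ → ℕ
partner x with parity x
... | 1ℙ = suc x
... | 0ℙ = pred x

-- D 0 is empty.
data DVertex : ℕ → Set where
  plain : ∀ {k} → Fin k → DVertex k
  bar   : ∀ {k} → Fin k → DVertex k
  inner : ∀ {k} → DVertex ⌈ 3 + k /2⌉ → DVertex (3 + k)

data DEdge : (k : ℕ) → DVertex k → DVertex k → Set where
  one-two : DEdge 2 (plain zero) (bar (suc zero))
  two-one : DEdge 2 (plain (suc zero)) (bar zero)
  across  : ∀ {k} {x y : Fin (3 + k)} → number y ≡ partner (number x) →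
            DEdge (3 + k) (plain x) (bar y)
  down    : ∀ {k} {x : Fin (3 + k)} {z} → number z ≡ ⌈ number x /2⌉ →
            DEdge (3 + k) (plain x) (inner (plain z))
  up      : ∀ {k} {x : Fin (3 + k)} {z} → number z ≡ ⌈ number x /2⌉ →
            DEdge (3 + k) (inner (bar z)) (bar x)
  inner   : ∀ {k} {p q} → DEdge ⌈ 3 + k /2⌉ p q → DEdge (3 + k) (inner p) (inner q)

-- A bijective renaming, at every vertex v, of 1, …, k_v by the labels at v.
-- It is phrased without a type of labels at v because proofs of LabelAt are
-- not unique (several edges at v may carry the same label).
record Renaming {ℓ} (G : Graph ℓ) : Set ℓ where
  open Graph G
  field
    name           : ∀ v → Fin (#labelsAt G v) → Label
    name-injective : ∀ v → Injective _≡_ _≡_ (name v)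
    name-sound     : ∀ v i → LabelAt G v (name v i)
    name-complete  : ∀ v {x} → LabelAt G v x → ∃[ i ] name v i ≡ x

module _ {ℓ} {G : Graph ℓ} (R : Renaming G) where
  open Graph G
  open Renaming R

  NrVertex : Set
  NrVertex = Σ Vertex λ v → DVertex (#labelsAt G v)

  data NrEdge : NrVertex → NrVertex → Set ℓ where
    intra : ∀ {v p q} → DEdge (#labelsAt G v) p q → NrEdge (v , p) (v , q)
    inter : ∀ {v w i j} (a : Arc G v w) →
            name v i ≡ label (edge a) → name w j ≡ label (edge a) →
            NrEdge (v , bar i) (w , plain j)

  NrPath : NrVertex → NrVertex → Set ℓ
  NrPath = Star NrEdge

module _ {ℓ} {G : Graph ℓ} {R : Renaming G} where
  open Graph G

  gadgetsEntered : ∀ {p q} → NrPath R p q → List Vertex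
  gadgetsEntered ε                           = []
  gadgetsEntered (intra _             ◅ π)   = gadgetsEntered π
  gadgetsEntered (inter {w = w} _ _ _ ◅ π)   = w ∷ gadgetsEntered π

  gadgets : ∀ {p q} → NrPath R p q → List Vertex
  gadgets {v , _} π = v ∷ gadgetsEntered π

  interGadgetEdges : ∀ {p q} → NrPath R p q → List Edge
  interGadgetEdges ε                 = []
  interGadgetEdges (intra _     ◅ π) = interGadgetEdges π
  interGadgetEdges (inter a _ _ ◅ π) = edge a ∷ interGadgetEdges π

private
  lookup-injective : ∀ {a} {A : Set a} {xs : List A} → Unique xs → Injective _≡_ _≡_ (lookup xs)
  lookup-injective (_  ∷ _) {zero}  {zero}  _  = refl
  lookup-injective (x∉ ∷ _) {zero}  {suc j} eq = ⊥-elim (All-lookup x∉ (∈-lookup j) eq)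
  lookup-injective (x∉ ∷ _) {suc i} {zero}  eq = ⊥-elim (All-lookup x∉ (∈-lookup i) (sym eq))
  lookup-injective (_  ∷ u) {suc i} {suc j} eq = cong suc (lookup-injective u eq)

renaming-exists : ∀ {ℓ} (G : Graph ℓ) → Renaming G
renaming-exists G = record
  { name           = λ v → lookup (labelsAt G v)
  ; name-injective = λ v → lookup-injective (UniqueDec.deduplicate-! _≟ᴸ_ (map label (edgesAt G v)))
  ; name-sound     = λ v i → sound v (∈-lookup i)
  ; name-complete  = λ v at → let x∈ = complete v at in index x∈ , sym (lookup-index x∈)
  }
  where
  open Graph G

  sound : ∀ v {x} → x ∈ labelsAt G v → LabelAt G v x
  sound v x∈ with ∈-map⁻ label (∈-deduplicate⁻ _≟ᴸ_ _ x∈)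
  ... | e , e∈ , x≡ = e , proj₂ (∈-filter⁻ (incident? G v) {xs = allFin #edges} e∈) , sym x≡

  complete : ∀ v {x} → LabelAt G v x → x ∈ labelsAt G v
  complete v (e , inc , refl) =
    ∈-deduplicate⁺ _≟ᴸ_ (∈-map⁺ label (∈-filter⁺ (incident? G v) (∈-allFin e) inc))

{-# OPTIONS --safe #-}

-- In D_k, a path from x to ȳ exists exactly when x ≠ y.  So a path in nr(G)
-- that enters a gadget along an edge labeled x cannot leave it along another
-- edge labeled x, while every other label at the vertex remains available.
module Submission where

open import Defs
open import Data.Product using (_×_; proj₁; ∃-syntax)
open import Relation.Binary.PropositionalEquality using (_≡_)

open import Data.Fin.Base using (Fin; zero; suc; toℕ)
open import Data.Fin.Properties using (toℕ-injective) renaming (_≟_ to _≟ᶠ_)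
open import Data.List.Base using (_∷_; map)
open import Data.List.Relation.Unary.Linked using (Linked; []; [-]; _∷_; head; tail)
open import Data.Nat.Base using (ℕ; suc; _+_; parity; ⌊_/2⌋; ⌈_/2⌉; _<_)
open import Data.Nat.Induction using (Acc; acc; <-wellFounded)
open import Data.Nat.Properties using (⌈n/2⌉<n; 1+n≢n; suc-injective)
open import Data.Parity.Base using (0ℙ; 1ℙ)
open import Data.Product using (_,_)
open import Data.Sum.Base using (inj₁; inj₂)
open import Function.Base using (_∘_)
open import Relation.Binary.Construct.Closure.ReflexiveTransitive using (Star; ε; _◅_; _◅◅_; gmap)
open import Relation.Binary.PropositionalEquality using (_≢_; refl; sym; trans; cong)
open import Relation.Nullary.Decidable using (yes; no)
open import Relation.Nullary.Negation using (contradiction)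

partner[1+n]≢1+n : ∀ n → partner (suc n) ≢ suc n
partner[1+n]≢1+n n with parity (suc n)
... | 1ℙ = 1+n≢n
... | 0ℙ = 1+n≢n ∘ sym

partner[3+n]≡2+partner[1+n] : ∀ n → partner (suc (suc (suc n))) ≡ suc (suc (partner (suc n)))
partner[3+n]≡2+partner[1+n] 0 = refl
partner[3+n]≡2+partner[1+n] (suc n) with parity n
... | 1ℙ = refl
... | 0ℙ = refl

-- Here `m` and `n` are zero-based, so the pairs of partners are {0, 1}, {2, 3}, ...: exactly the
-- fibres of the rounded-down half. Induction goes by steps of two, with which `partner` commutes.
⌊m/2⌋≡⌊n/2⌋∧m≢n⇒partner : ∀ m n → ⌊ m /2⌋ ≡ ⌊ n /2⌋ → m ≢ n → suc n ≡ partner (suc m)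
⌊m/2⌋≡⌊n/2⌋∧m≢n⇒partner 0 0 _ m≢n = contradiction refl m≢n
⌊m/2⌋≡⌊n/2⌋∧m≢n⇒partner 0 1 _ _   = refl
⌊m/2⌋≡⌊n/2⌋∧m≢n⇒partner 1 0 _ _   = refl
⌊m/2⌋≡⌊n/2⌋∧m≢n⇒partner 1 1 _ m≢n = contradiction refl m≢n
⌊m/2⌋≡⌊n/2⌋∧m≢n⇒partner (suc (suc m)) (suc (suc n)) eq m≢n =
  trans (cong (2 +_)
          (⌊m/2⌋≡⌊n/2⌋∧m≢n⇒partner m n (suc-injective eq) (m≢n ∘ cong (2 +_))))
        (sym (partner[3+n]≡2+partner[1+n] m))

half : ∀ {k} → Fin k → Fin ⌈ k /2⌉
half zero          = zero
half (suc zero)    = zero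
half (suc (suc i)) = suc (half i)

number-half : ∀ {k} (i : Fin k) → number (half i) ≡ ⌈ number i /2⌉
number-half zero          = refl
number-half (suc zero)    = refl
number-half (suc (suc i)) = cong suc (number-half i)

-- An invariant of the vertices reachable from plain n; at depth d inside the
-- nested gadgets, n is represented by its d-fold rounded-up half.
Reachable : ∀ {k} → ℕ → DVertex k → Set
Reachable n (plain i) = number i ≡ n
Reachable n (bar i)   = number i ≢ n
Reachable n (inner p) = Reachable ⌈ n /2⌉ p

-- `across` leads to the partner, which is never the number itself. `down` halves both the vertex
-- and `n`. After `up`, a number equal to `n` would have the same half as `n`, which the invariant
-- excludes inside.
Reachable-step : ∀ {k p q} n → DEdge k p q → Reachable n p → Reachable n q
Reachable-step _ one-two refl ()
Reachable-step _ two-one refl ()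
Reachable-step _ (across {x = x} y≡) refl y≡x = partner[1+n]≢1+n (toℕ x) (trans (sym y≡) y≡x)
Reachable-step _ (down z≡) refl = z≡
Reachable-step _ (up z≡) z≢ refl = z≢ z≡
Reachable-step n (inner e) = Reachable-step ⌈ n /2⌉ e

-- If the halves differ, the path goes through the inner gadget, by induction; if they agree, `x`
-- and `y` are partners and `across` joins them. The recursion is on the size because `⌈ k /2⌉` is
-- not structurally smaller than `k`.
plain⟶bar : ∀ {k} → Acc _<_ k → {x y : Fin k} → x ≢ y → Star (DEdge k) (plain x) (bar y)
plain⟶bar {1} _ {zero} {zero} x≢y = contradiction refl x≢y
plain⟶bar {2} _ {zero} {zero} x≢y = contradiction refl x≢y
plain⟶bar {2} _ {zero} {suc zero} _ = one-two ◅ ε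
plain⟶bar {2} _ {suc zero} {zero} _ = two-one ◅ ε
plain⟶bar {2} _ {suc zero} {suc zero} x≢y = contradiction refl x≢y
plain⟶bar {suc (suc (suc k))} (acc rec) {x} {y} x≢y with half x ≟ᶠ half y
... | no hx≢hy =
  down (number-half x) ◅ gmap inner inner (plain⟶bar (rec (⌈n/2⌉<n (suc k))) hx≢hy)
    ◅◅ up (number-half y) ◅ ε
... | yes hx≡hy = across (⌊m/2⌋≡⌊n/2⌋∧m≢n⇒partner (toℕ x) (toℕ y) ⌊x/2⌋≡⌊y/2⌋ (x≢y ∘ toℕ-injective)) ◅ ε
  where
  ⌊x/2⌋≡⌊y/2⌋ : ⌊ toℕ x /2⌋ ≡ ⌊ toℕ y /2⌋
  -- `⌈ number x /2⌉` reduces to `suc ⌊ toℕ x /2⌋`.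
  ⌊x/2⌋≡⌊y/2⌋ = suc-injective
    (trans (sym (number-half x)) (trans (cong number hx≡hy) (number-half y)))

module _ {ℓ} {G : Graph ℓ} (R : Renaming G) where
  open Graph G
  open Renaming R

  project : ∀ {p q} → NrPath R p q → Path G (proj₁ p) (proj₁ q)
  project ε                 = ε
  project (intra _ ◅ π)     = project π
  project (inter a _ _ ◅ π) = a ◅ project π

  vertices-project : ∀ {p q} (π : NrPath R p q) → vertices (project π) ≡ gadgets π
  vertices-project ε                         = refl
  vertices-project (intra _ ◅ π)             = vertices-project π
  vertices-project (inter {v = v} _ _ _ ◅ π) = cong (v ∷_) (vertices-project π)

  edges-project : ∀ {p q} (π : NrPath R p q) → edges (project π) ≡ interGadgetEdges π
  edges-project ε                 = refl
  edges-project (intra _ ◅ π)     = edges-project π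
  edges-project (inter a _ _ ◅ π) = cong (edge a ∷_) (edges-project π)

  -- `x` is the label on which the gadget of `v` was entered. On leaving from a barred vertex the
  -- invariant gives a number other than that of `i`, hence another label by injectivity of `name`;
  -- entering the next gadget at `plain j` starts the invariant afresh.
  project-avoids : ∀ {v p q x} (i : Fin (#labelsAt G v)) → name v i ≡ x → Reachable (number i) p →
                   (π : NrPath R (v , p) q) → Linked _≢_ (x ∷ map label (edges (project π)))
  project-avoids i _ r ε = [-]
  project-avoids i eq r (intra e ◅ π) = project-avoids i eq (Reachable-step (number i) e r) π
  project-avoids {v} i refl r (inter {j = j} a out in' ◅ π) =
    (λ eq → r (cong number (name-injective v (trans out (sym eq)))))
    ∷ project-avoids j in' refl π

  -- The path may start anywhere in a gadget, so the invariant is set up only at the first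
  -- inter-gadget edge.
  project-nonrepetitive : ∀ {p q} (π : NrPath R p q) → Nonrepetitive (project π)
  project-nonrepetitive ε = []
  project-nonrepetitive (intra _ ◅ π) = project-nonrepetitive π
  project-nonrepetitive (inter {j = j} a _ in' ◅ π) = project-avoids j in' refl π

  source-label : ∀ {v w} (a : Arc G v w) → LabelAt G v (label (edge a))
  source-label (forward e)    = e , inj₁ refl , refl
  source-label (backward _ e) = e , inj₂ refl , refl

  target-label : ∀ {v w} (a : Arc G v w) → LabelAt G w (label (edge a))
  target-label (forward e)    = e , inj₂ refl , refl
  target-label (backward _ e) = e , inj₁ refl , refl

  gadgetsEntered-intra : ∀ {v p p′ q} (σ : Star (DEdge (#labelsAt G v)) p p′)
                         (π : NrPath R (v , p′) q) →
                         gadgetsEntered (gmap (v ,_) intra σ ◅◅ π) ≡ gadgetsEntered π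
  gadgetsEntered-intra ε       π = refl
  gadgetsEntered-intra (_ ◅ σ) π = gadgetsEntered-intra σ π

  -- The label `x` of arrival is prepended so that the hypothesis also forbids leaving on it. The
  -- two lemmas alternate: cross a gadget to the barred vertex of the next label, then follow the
  -- arc.
  lift-from-plain : ∀ {v w x} (i : Fin (#labelsAt G v)) → name v i ≡ x →
                    (π : Path G v w) → Linked _≢_ (x ∷ map label (edges π)) →
                    ∃[ q ] ∃[ ρ ] (gadgets {R = R} {v , plain i} {q} ρ ≡ vertices π)
  lift-from-bar   : ∀ {v w} (i : Fin (#labelsAt G v)) {u} (a : Arc G v u) →
                    name v i ≡ label (edge a) → (π : Path G u w) → Nonrepetitive (a ◅ π) →
                    ∃[ q ] ∃[ ρ ] (gadgets {R = R} {v , bar i} {q} ρ ≡ vertices (a ◅ π))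

  lift-from-plain i _ ε _ = _ , ε , refl
  lift-from-plain {v} i refl (a ◅ π) nr
    with name-complete v (source-label a)
  ... | j , out with lift-from-bar j a out π (tail nr)
  ... | q , ρ , eq =
    q , gmap (v ,_) intra σ ◅◅ ρ , trans (cong (v ∷_) (gadgetsEntered-intra σ ρ)) eq
    where
    σ : Star (DEdge (#labelsAt G v)) (plain i) (bar j)
    -- If `i` and `j` were equal, the next label would repeat `name v i`.
    σ = plain⟶bar (<-wellFounded _) λ { refl → head nr out }

  lift-from-bar {v} i {u} a out π nr
    with name-complete u (target-label a)
  ... | j , in' with lift-from-plain j in' π nr
  ... | q , ρ , eq = q , inter a out in' ◅ ρ , cong (v ∷_) eq

  lift : NoIsolatedVertices G → ∀ {u v} (π : Path G u v) → Nonrepetitive π →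
         ∃[ p ] ∃[ q ] ∃[ ρ ] (gadgets {R = R} {p} {q} ρ ≡ vertices π)
  lift noIsolated {u} ε _ =
    -- The gadget of `u` must have a vertex to start from; an incident edge supplies a label, hence
    -- one.
    let e , inc = noIsolated u
        i , _   = name-complete u (e , inc , refl)
    in (u , plain i) , _ , ε , refl
  lift _ {u} (a ◅ π) nr =
    let i , out = name-complete u (source-label a)
    in (u , bar i) , lift-from-bar i a out π nr

lemma2 : ∀ {ℓ} (G : Graph ℓ) → NoIsolatedVertices G → (R : Renaming G) →
    (∀ {p q} (π : NrPath R p q) →
    ∃[ ρ ] (vertices {G = G} {proj₁ p} {proj₁ q} ρ ≡ gadgets π
    × edges ρ ≡ interGadgetEdges π
    × Nonrepetitive ρ))
    ×
    (∀ {u v} (π : Path G u v) → Nonrepetitive π →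
    ∃[ p ] ∃[ q ] ∃[ ρ ] (gadgets {R = R} {p} {q} ρ ≡ vertices π))
lemma2 G noIsolated R =
  (λ π → project R π , vertices-project R π , edges-project R π , project-nonrepetitive R π) ,
  lift R noIsolated
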